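{- Let $q$ be an odd prime power and let $G$ be a graph with $k$ vertices. Then $i_P(G)\le\lceil\log_3\log_q((k-1)2^{k-2})\rceil$.
   Context: For a prime power $r\equiv1\pmod 4$, the Paley graph $P(r)$ has vertex set $\mathbb{F}_r$, with $u,v$ adjacent iff $u-v$ is a nonzero square in $\mathbb{F}_r$. For $n\ge1$ let $P_n=P((q^2)^{3^n})$, and $i_P(G)=\min\{n\ge1 : G\text{ is an induced subgraph of }P_n\}$.
   Formalization: The bound is read as max(1, ⌈log_3 log_q((k−1)2^{k−2})⌉): since i_P(G) ≥ 1 by definition, the literal bound fails when (k−1)2^{k−2} ≤ q (e.g. q=5, k=3, where the ceiling is 0) and is undefined for k ≤ 2. -}

module Defs where

open import Level using (Level; _⊔_) renaming (suc to lsuc)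
open import Data.Nat using (ℕ; suc; _^_; _≤_)
open import Data.Nat.Primality using (Prime)
open import Data.Fin using (Fin)
open import Data.Bool using (Bool; true; false)
open import Data.Product public using (Σ; _×_; _,_)
open import Relation.Nullary using (¬_; Dec)
open import Relation.Binary.PropositionalEquality using (_≡_; _≢_)
open import Algebra.Bundles using (CommutativeRing)
open import Function.Bundles using (_⇔_)

OddPrimePower : ℕ → Set
OddPrimePower q = Σ ℕ λ p → Σ ℕ λ a → Prime p × p ≢ 2 × q ≡ p ^ suc a

record FiniteField (c ℓ : Level) (r : ℕ) : Set (lsuc (c ⊔ ℓ)) where
  field
    commRing   : CommutativeRing c ℓ
  open CommutativeRing commRing public
  field
    _≟_        : (x y : Carrier) → Dec (x ≈ y)
    0≉1        : ¬ (0# ≈ 1#)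
    inverse    : (x : Carrier) → ¬ (x ≈ 0#) → Σ Carrier λ y → x * y ≈ 1#
    enum       : Fin r → Carrier
    enum-inj   : (i j : Fin r) → enum i ≈ enum j → i ≡ j
    enum-surj  : (x : Carrier) → Σ (Fin r) λ i → enum i ≈ x

PaleyAdj : ∀ {c ℓ r} (F : FiniteField c ℓ r) → FiniteField.Carrier F → FiniteField.Carrier F → Set (c ⊔ ℓ)
PaleyAdj F u v = ¬ (u - v ≈ 0#) × Σ Carrier λ s → s * s ≈ u - v
  where open FiniteField F

record Graph (k : ℕ) : Set where
  field
    adj   : Fin k → Fin k → Bool
    sym   : (i j : Fin k) → adj i j ≡ adj j i
    irrefl : (i : Fin k) → adj i i ≡ false

InducedInPaley : ∀ {k c ℓ r} → Graph k → FiniteField c ℓ r → Set (c ⊔ ℓ)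
InducedInPaley {k} G F =
  Σ (Fin k → Carrier) λ f →
    ((i j : Fin k) → f i ≈ f j → i ≡ j) ×
    ((i j : Fin k) → (Graph.adj G i j ≡ true) ⇔ PaleyAdj F (f i) (f j))
  where open FiniteField F

-- G is an induced subgraph of P_n = P((q^2)^(3^n)); the Paley graph of order r
-- is defined up to isomorphism via any field of order r (all such are isomorphic).
InP : ∀ {k} (c ℓ : Level) (q n : ℕ) → Graph k → Set (lsuc (c ⊔ ℓ))
InP c ℓ q n G = (F : FiniteField c ℓ ((q ^ 2) ^ (3 ^ n))) → InducedInPaley G F

iP≤ : ∀ {k} (c ℓ : Level) (q : ℕ) → Graph k → ℕ → Set (lsuc (c ⊔ ℓ))
iP≤ c ℓ q G m = Σ ℕ λ n → 1 ≤ n × n ≤ m × InP c ℓ q n G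

{-# OPTIONS --safe #-}
module Submission where

-- Write Q = q^(3^n), so that the field has Q² elements, and let χ be its quadratic
-- character.  Counting the solutions of s² − t² = x − y gives
-- Σ_v χ(x − v) χ(y − v) = −1 for x ≠ y, hence Σ_v (Σ_{x ∈ U} χ(x − v))² = r|U| − |U|²
-- for every set U of vertices, where r = Q².  The vertices of G are embedded one at
-- a time, keeping for each of the m vertices still to come a set of candidates, all
-- of the same size.  By the second moment, the next candidate set contains a v for
-- which every other candidate set U has |Σ_{x ∈ U} χ(x − v)| < mQ, so about half of U
-- is correctly joined to v.  The sets never run out as long as 2^k ≤ Q, and this
-- follows from (k − 1) 2^(k−2) ≤ Q for k ≥ 5, and from Q ≥ 27 for k ≤ 4.

open import Defs
open import Level using (Level; _⊔_)
open import Data.Nat.Base as ℕ using (zero; suc)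
import Data.Nat.Properties as ℕ
open import Data.Nat.DivMod using (_%_; _/_; m%n<n; m≡m%n+[m/n]*n)
open import Data.Nat.Divisibility using (_∤_; ∣1⇒≡1; m%n≡0⇒n∣m)
open import Data.Nat.Primality using (Prime; prime⇒irreducible; prime⇒nonTrivial; prime[2]; euclidsLemma)
open import Data.Nat.Tactic.RingSolver using () renaming (solve-∀ to ℕ-solve-∀)
open import Data.Bool.Base using (Bool; true; false; _∧_)
import Data.Bool.Properties as Bool using (_≟_)
open import Data.Fin.Base using (Fin; zero; suc)
open import Data.Fin.Properties using (_≟_; _<?_; <-cmp; any?; suc-injective)
open import Data.Fin.Permutation using (permutation)
open import Data.Product.Base using (∃; proj₁; proj₂)
open import Data.Sum.Base using (_⊎_; inj₁; inj₂; [_,_]′)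
open import Data.Vec.Functional using (_∷_)
open import Function.Base using (_∘_)
open import Function.Bundles using (mk⇔)
open import Relation.Binary.Definitions using (tri<; tri≈; tri>)
open import Relation.Binary.PropositionalEquality
open import Relation.Nullary using (Dec; yes; no; does; ¬_; contradiction)
open import Relation.Nullary.Decidable using (_×-dec_; ¬?; dec-true; dec-false; map′)
import Algebra.Properties.Group
import Algebra.Properties.Ring
import Algebra.Properties.Semiring.Sum
import Algebra.Solver.Ring.NaturalCoefficients.Default
import Relation.Binary.Reasoning.Setoid

module PaleyUniversality where

  open import Data.Nat.Base using (ℕ)
  open import Data.Integer.Base using (ℤ; +_; -[1+_]; 0ℤ; 1ℤ; -1ℤ; _+_; _*_; _-_; -_; _≤_; _<_; +≤+; +<+; -≤+; nonNegative; ∣_∣)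
  open import Data.Integer.Properties hiding (_≟_; _<?_; <-cmp)
  import Data.Integer.Properties as ℤ using (_≟_)
  open import Data.Integer.Tactic.RingSolver using (solve-∀)
  open Algebra.Properties.Semiring.Sum +-*-semiring using (sum; sum-cong-≗; sum-permute; ∑-comm; ∑-distrib-+; *-distribˡ-sum; *-distribʳ-sum)

  -- Finite sums of integers.

  sum-mono-≤ : ∀ {n} {f g : Fin n → ℤ} → (∀ i → f i ≤ g i) → sum f ≤ sum g
  sum-mono-≤ {zero}  f≤g = ≤-refl
  sum-mono-≤ {suc n} f≤g = +-mono-≤ (f≤g zero) (sum-mono-≤ (f≤g ∘ suc))

  sum-const : ∀ n c → sum {n} (λ _ → c) ≡ + n * c
  sum-const zero    c = refl
  sum-const (suc n) c = trans (cong (_+_ c) (sum-const n c)) (sym (suc-* (+ n) c))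

  sum-zero : ∀ {n} {f : Fin n → ℤ} → (∀ i → f i ≡ 0ℤ) → sum f ≡ 0ℤ
  sum-zero {n} f≡0 = trans (sum-cong-≗ f≡0) (trans (sum-const n 0ℤ) (*-zeroʳ (+ n)))

  sum-only : ∀ {n} (f : Fin n → ℤ) i → (∀ j → j ≢ i → f j ≡ 0ℤ) → sum f ≡ f i
  sum-only f zero    f≡0 =
    trans (cong (_+_ (f zero)) (sum-zero (λ j → f≡0 (suc j) λ ()))) (+-identityʳ _)
  sum-only f (suc i) f≡0 =
    trans (cong₂ _+_ (f≡0 zero λ ()) (sum-only (f ∘ suc) i (λ j j≢i → f≡0 (suc j) (j≢i ∘ suc-injective))))
          (+-identityˡ _)

  sum-minus : ∀ {n} (f g : Fin n → ℤ) → sum (λ i → f i - g i) ≡ sum f - sum g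
  sum-minus f g = begin
    sum (λ i → f i - g i)          ≡⟨ ∑-distrib-+ f (-_ ∘ g) ⟩
    sum f + sum (-_ ∘ g)           ≡⟨ cong (_+_ (sum f)) (sum-cong-≗ (sym ∘ -1*i≡-i ∘ g)) ⟩
    sum f + sum (λ i → -1ℤ * g i)  ≡⟨ cong (_+_ (sum f)) (*-distribˡ-sum -1ℤ g) ⟨
    sum f + -1ℤ * sum g            ≡⟨ cong (_+_ (sum f)) (-1*i≡-i _) ⟩
    sum f - sum g                  ∎
    where open ≡-Reasoning

  ≤-sum : ∀ {n} {f : Fin n → ℤ} → (∀ i → 0ℤ ≤ f i) → ∀ i → f i ≤ sum f
  ≤-sum {suc n} {f} f≥0 zero    =
    subst (_≤ sum f) (+-identityʳ _)
      (+-monoʳ-≤ (f zero) (subst (_≤ sum (f ∘ suc)) (sum-zero {n} (λ _ → refl)) (sum-mono-≤ (f≥0 ∘ suc))))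
  ≤-sum {suc n} {f} f≥0 (suc i) =
    subst (_≤ sum f) (+-identityˡ _) (+-mono-≤ (f≥0 zero) (≤-sum (f≥0 ∘ suc) i))

  -- Subsets of a finite set, and averaging over them.

  ⟦_⟧ : Bool → ℤ
  ⟦ true  ⟧ = 1ℤ
  ⟦ false ⟧ = 0ℤ

  ⟦b⟧²≡⟦b⟧ : ∀ b → ⟦ b ⟧ * ⟦ b ⟧ ≡ ⟦ b ⟧
  ⟦b⟧²≡⟦b⟧ true  = refl
  ⟦b⟧²≡⟦b⟧ false = refl

  0≤i² : ∀ i → 0ℤ ≤ i * i
  0≤i² (+ n)      = subst (0ℤ ≤_) (pos-* n n) (+≤+ ℕ.z≤n)
  0≤i² -[1+ n ]   = +≤+ ℕ.z≤n

  size : ∀ {r} → (Fin r → Bool) → ℤ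
  size U = sum (λ x → ⟦ U x ⟧)

  _⊆_ : ∀ {r} → (Fin r → Bool) → (Fin r → Bool) → Set
  V ⊆ U = ∀ x → V x ≡ true → U x ≡ true

  -- Trims candidate sets to one common size. In `choose` the size of the set that is averaged over
  -- has to match the sizes inside the second moment.
  shrink : ∀ {r} (U : Fin r → Bool) t → + t ≤ size U →
           ∃ λ V → V ⊆ U × size V ≡ + t
  shrink {r}     U zero    _ = (λ _ → false) , (λ _ ()) , sum-zero {r} (λ _ → refl)
  shrink {zero}  U (suc t) (+≤+ ())
  shrink {suc r} U (suc t) t≤ with U zero in U0
  ... | true  =
    let V , V⊆U , ∣V∣ = shrink (U ∘ suc) t (+-cancelˡ-≤ 1ℤ t≤)
    in  true ∷ V , (λ { zero _ → U0 ; (suc x) → V⊆U x }) , cong (_+_ 1ℤ) ∣V∣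
    where
    +-cancelˡ-≤ : ∀ i {j k} → i + j ≤ i + k → j ≤ k
    +-cancelˡ-≤ i {j} {k} le = subst₂ _≤_ (lem i j) (lem i k) (+-monoʳ-≤ (- i) le)
      where
      lem : ∀ i j → - i + (i + j) ≡ j
      lem = solve-∀
  ... | false =
    let V , V⊆U , ∣V∣ = shrink (U ∘ suc) (suc t) (subst (+ suc t ≤_) (+-identityˡ _) t≤)
    in  false ∷ V , (λ { zero () ; (suc x) → V⊆U x }) , trans (+-identityˡ _) ∣V∣

  -- The total runs over all points, not just over `V`, which is harmless because `f` is
  -- nonnegative. If every point of `V` had `f v > C`, integrality would give `f v ≥ 1 + C`, and the
  -- total would be at least `size V * (1ℤ + C)`, forcing `size V ≤ 0`.
  exists-≤-average : ∀ {r} (f : Fin r → ℤ) (V : Fin r → Bool) C → (∀ v → 0ℤ ≤ f v) →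
                     0ℤ < size V → sum f ≤ size V * C → ∃ λ v → V v ≡ true × f v ≤ C
  exists-≤-average f V C f≥0 ∣V∣>0 total with any? (λ v → (V v Bool.≟ true) ×-dec (f v ≤? C))
  ... | yes found = found
  ... | no ∄v     = contradiction ∣V∣>0 (≤⇒≯ (0≤i-j⇒j≤i (subst (0ℤ ≤_) (cancel (size V) C) (i≤j⇒0≤j-i excess))))
    where
    cancel : ∀ a c → a * c - a * (1ℤ + c) ≡ 0ℤ - a
    cancel = solve-∀
    large : ∀ v → ⟦ V v ⟧ * (1ℤ + C) ≤ f v
    large v with V v in Vv
    ... | false = f≥0 v
    ... | true  = subst (_≤ f v) (sym (*-identityˡ (1ℤ + C))) (i<j⇒suc[i]≤j (≰⇒> λ fv≤C → ∄v (v , Vv , fv≤C)))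
    excess : size V * (1ℤ + C) ≤ size V * C
    excess = begin
      size V * (1ℤ + C)                   ≡⟨ *-distribʳ-sum (1ℤ + C) (λ v → ⟦ V v ⟧) ⟩
      sum (λ v → ⟦ V v ⟧ * (1ℤ + C))      ≤⟨ sum-mono-≤ large ⟩
      sum f                               ≤⟨ total ⟩
      size V * C                          ∎
      where open ≤-Reasoning

  a²<b²⇒a<b : ∀ {a} b → a * a < + b * + b → a < + b
  a²<b²⇒a<b {a} b a²<b² = ≰⇒> λ b≤a → contradiction a²<b² (≤⇒≯ (begin
    + b * + b ≤⟨ *-monoˡ-≤-nonNeg (+ b) b≤a ⟩
    + b * a   ≤⟨ *-monoʳ-≤-nonNeg a {{nonNegative (≤-trans (+≤+ ℕ.z≤n) b≤a)}} b≤a ⟩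
    a * a     ∎))
    where open ≤-Reasoning

  -- Thresholds and Paley matrices.

  sgn : Bool → ℤ
  sgn true  = 1ℤ
  sgn false = -1ℤ

  -- A candidate-set size that suffices when m vertices remain to be embedded: a set of
  -- size t still has at least (t − m Q) / 2 elements after a vertex is chosen and m remain.
  threshold : ℕ → ℕ → ℕ
  threshold Q zero    = 1
  threshold Q (suc m) = 2 ℕ.* threshold Q m ℕ.+ m ℕ.* Q

  0<threshold : ∀ Q m → 0 ℕ.< threshold Q m
  0<threshold Q zero    = ℕ.s≤s ℕ.z≤n
  0<threshold Q (suc m) = ℕ.<-≤-trans (0<threshold Q m) (ℕ.≤-trans (ℕ.m≤m+n _ _) (ℕ.m≤m+n _ _))

  -- Seidel matrices of graphs with the parameters of a Paley graph.
  record IsPaleyMatrix {r} (M : Fin r → Fin r → ℤ) : Set where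
    field
      diagonal   : ∀ x → M x x ≡ 0ℤ
      sign       : ∀ {x y} → x ≢ y → M x y ≡ 1ℤ ⊎ M x y ≡ -1ℤ
      symmetric  : ∀ x y → M x y ≡ M y x
      orthogonal : ∀ {x y} → x ≢ y → sum (λ v → M x v * M y v) ≡ -1ℤ

  module _ {r} {M : Fin r → Fin r → ℤ} (paley : IsPaleyMatrix M) where
    open IsPaleyMatrix paley

    -- The second moment of a Paley matrix.

    δ : Fin r → Fin r → ℤ
    δ x y = ⟦ does (x ≟ y) ⟧

    sum-δ : ∀ (w : Fin r → ℤ) x → sum (λ y → w y * δ x y) ≡ w x
    sum-δ w x = trans (sum-only _ x off) on
      where
      off : ∀ y → y ≢ x → w y * δ x y ≡ 0ℤ
      off y y≢x rewrite dec-false (x ≟ y) (y≢x ∘ sym) = *-zeroʳ (w y)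
      on : w x * δ x x ≡ w x
      on rewrite dec-true (x ≟ x) refl = *-identityʳ (w x)

    -- The factor `1ℤ` in front of `δ x v` is the constant weight with which `sum-δ` is later
    -- applied.
    square-entry : ∀ x v → M x v * M x v ≡ 1ℤ - 1ℤ * δ x v
    square-entry x v with x ≟ v
    ... | yes refl = cong₂ _*_ (diagonal x) (diagonal x)
    ... | no x≢v with sign x≢v
    ...   | inj₁ e = cong₂ _*_ e e
    ...   | inj₂ e = cong₂ _*_ e e

    -- In matrix form, M times its transpose is r I - J. A row has r - 1 entries ±1 and one entry 0,
    -- which gives the diagonal; `orthogonal` gives the rest.
    gram : ∀ x y → sum (λ v → M x v * M y v) ≡ + r * δ x y - 1ℤ
    gram x y with x ≟ y
    ... | no x≢y   = trans (orthogonal x≢y) (cong (_- 1ℤ) (sym (*-zeroʳ (+ r))))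
    ... | yes refl = begin
      sum (λ v → M x v * M x v)                   ≡⟨ sum-cong-≗ (square-entry x) ⟩
      sum (λ v → 1ℤ - 1ℤ * δ x v)                 ≡⟨ sum-minus (λ _ → 1ℤ) (λ v → 1ℤ * δ x v) ⟩
      sum {r} (λ _ → 1ℤ) - sum (λ v → 1ℤ * δ x v) ≡⟨ cong₂ _-_ (sum-const r 1ℤ) (sum-δ (λ _ → 1ℤ) x) ⟩
      + r * 1ℤ - 1ℤ                               ∎
      where open ≡-Reasoning

    -- For the indicator of a set U this is the number of neighbours of `v` in U minus the number of
    -- non-neighbours, with `v` itself counted as 0.
    dev : (Fin r → ℤ) → Fin r → ℤ
    dev w v = sum (λ x → w x * M x v)

    -- The left side is the quadratic form of the Gram matrix at w. Since that matrix is r I - J,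
    -- the form is r times the sum of the squares of w minus the square of its sum.
    second-moment : ∀ w → sum (λ v → dev w v * dev w v) ≡ + r * sum (λ x → w x * w x) - sum w * sum w
    second-moment w = begin
      sum (λ v → dev w v * dev w v)
        ≡⟨ sum-cong-≗ (λ v → trans (*-distribʳ-sum (dev w v) (λ x → w x * M x v))
             (sum-cong-≗ λ x → trans (*-distribˡ-sum (w x * M x v) (λ y → w y * M y v))
               (sum-cong-≗ λ y → regroup (w x) (M x v) (w y) (M y v)))) ⟩
      sum (λ v → sum λ x → sum λ y → w x * (w y * (M x v * M y v)))
        ≡⟨ ∑-comm (λ v x → sum λ y → w x * (w y * (M x v * M y v))) ⟩
      sum (λ x → sum λ v → sum λ y → w x * (w y * (M x v * M y v)))
        ≡⟨ sum-cong-≗ (λ x → ∑-comm (λ v y → w x * (w y * (M x v * M y v)))) ⟩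
      sum (λ x → sum λ y → sum λ v → w x * (w y * (M x v * M y v)))
        ≡⟨ sum-cong-≗ (λ x → trans (sum-cong-≗ (pull x)) (sym (*-distribˡ-sum (w x) λ y → w y * (+ r * δ x y - 1ℤ)))) ⟩
      sum (λ x → w x * sum λ y → w y * (+ r * δ x y - 1ℤ))
        ≡⟨ sum-cong-≗ (λ x → trans (cong (w x *_) (inner x)) (expand (w x) (+ r) (sum w))) ⟩
      sum (λ x → + r * (w x * w x) - sum w * w x)
        ≡⟨ sum-minus (λ x → + r * (w x * w x)) (λ x → sum w * w x) ⟩
      sum (λ x → + r * (w x * w x)) - sum (λ x → sum w * w x)
        ≡⟨ cong₂ _-_ (*-distribˡ-sum (+ r) (λ x → w x * w x)) (*-distribˡ-sum (sum w) w) ⟨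
      + r * sum (λ x → w x * w x) - sum w * sum w ∎
      where
      open ≡-Reasoning
      regroup : ∀ a b c d → (a * b) * (c * d) ≡ a * (c * (b * d))
      regroup = solve-∀
      expand : ∀ a b c → a * (b * a - c) ≡ b * (a * a) - c * a
      expand = solve-∀
      spread : ∀ a b d → a * (b * d - 1ℤ) ≡ b * (a * d) - a
      spread = solve-∀
      pull : ∀ x y → sum (λ v → w x * (w y * (M x v * M y v))) ≡ w x * (w y * (+ r * δ x y - 1ℤ))
      pull x y = begin
        sum (λ v → w x * (w y * (M x v * M y v))) ≡⟨ *-distribˡ-sum (w x) (λ v → w y * (M x v * M y v)) ⟨
        w x * sum (λ v → w y * (M x v * M y v))   ≡⟨ cong (w x *_) (*-distribˡ-sum (w y) (λ v → M x v * M y v)) ⟨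
        w x * (w y * sum (λ v → M x v * M y v))   ≡⟨ cong (λ g → w x * (w y * g)) (gram x y) ⟩
        w x * (w y * (+ r * δ x y - 1ℤ))          ∎
      inner : ∀ x → sum (λ y → w y * (+ r * δ x y - 1ℤ)) ≡ + r * w x - sum w
      inner x = begin
        sum (λ y → w y * (+ r * δ x y - 1ℤ))      ≡⟨ sum-cong-≗ (λ y → spread (w y) (+ r) (δ x y)) ⟩
        sum (λ y → + r * (w y * δ x y) - w y)     ≡⟨ sum-minus (λ y → + r * (w y * δ x y)) w ⟩
        sum (λ y → + r * (w y * δ x y)) - sum w   ≡⟨ cong (_- sum w) (*-distribˡ-sum (+ r) (λ y → w y * δ x y)) ⟨
        + r * sum (λ y → w y * δ x y) - sum w     ≡⟨ cong (λ z → + r * z - sum w) (sum-δ w x) ⟩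
        + r * w x - sum w                         ∎

    -- Choosing one vertex.

    restrict : Fin r → Bool → (Fin r → Bool) → Fin r → Bool
    restrict v e U x = U x ∧ does (M x v ℤ.≟ sgn e)

    -- For x ≠ v the entry is ±1, so 1 + `sgn e * M x v` is twice the indicator of the wanted sign.
    -- At x = v the entry is 0, which never has the wanted sign; the summand `- 1ℤ` pays for this
    -- one point, and gives a strict loss when v is outside U.
    size-restrict : ∀ v e U → size U + sgn e * dev (λ x → ⟦ U x ⟧) v - 1ℤ ≤ + 2 * size (restrict v e U)
    size-restrict v e U = begin
      size U + sgn e * dev u v - 1ℤ
        ≡⟨ cong₂ (λ a b → size U + a - b) (*-distribˡ-sum (sgn e) (λ x → u x * M x v)) (sym (sum-δ (λ _ → 1ℤ) v)) ⟩
      size U + sum (λ x → sgn e * (u x * M x v)) - sum (λ x → 1ℤ * δ v x)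
        ≡⟨ cong (_- sum (λ x → 1ℤ * δ v x)) (∑-distrib-+ u (λ x → sgn e * (u x * M x v))) ⟨
      sum (λ x → u x + sgn e * (u x * M x v)) - sum (λ x → 1ℤ * δ v x)
        ≡⟨ sum-minus (λ x → u x + sgn e * (u x * M x v)) (λ x → 1ℤ * δ v x) ⟨
      sum (λ x → u x + sgn e * (u x * M x v) - 1ℤ * δ v x)
        ≤⟨ sum-mono-≤ (pointwise e) ⟩
      sum (λ x → + 2 * ⟦ restrict v e U x ⟧)
        ≡⟨ *-distribˡ-sum (+ 2) (λ x → ⟦ restrict v e U x ⟧) ⟨
      + 2 * size (restrict v e U) ∎
      where
      open ≤-Reasoning
      u : Fin r → ℤ
      u x = ⟦ U x ⟧
      pointwise : ∀ e x → u x + sgn e * (u x * M x v) - 1ℤ * δ v x ≤ + 2 * ⟦ restrict v e U x ⟧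
      pointwise e x with U x
      pointwise e x | false rewrite *-zeroʳ (sgn e) with does (v ≟ x)
      ... | true  = -≤+
      ... | false = ≤-refl
      pointwise e x | true with v ≟ x
      pointwise e x | true | yes refl rewrite diagonal v | *-zeroʳ (sgn e) with e
      ... | true  = ≤-refl
      ... | false = ≤-refl
      pointwise e x | true | no v≢x with e | sign (v≢x ∘ sym)
      ... | true  | inj₁ p rewrite p = ≤-refl
      ... | true  | inj₂ p rewrite p = ≤-refl
      ... | false | inj₁ p rewrite p = ≤-refl
      ... | false | inj₂ p rewrite p = ≤-refl

    -- Summed over all v and i, the squares amount to m (r t - t²) = t · m (r - t). As V also has t
    -- elements, t cancels: some v in V has Σ_i s_i(v)² ≤ m (r - t), and each single square is at
    -- most this sum.
    choose : ∀ {m t} (V : Fin r → Bool) (U : Fin m → Fin r → Bool) → 0 ℕ.< t →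
             size V ≡ + t → (∀ i → size (U i) ≡ + t) →
             ∃ λ v → V v ≡ true ×
               (∀ i → dev (λ x → ⟦ U i x ⟧) v * dev (λ x → ⟦ U i x ⟧) v ≤ + m * (+ r - + t))
    choose {m} {t} V U 0<t ∣V∣ ∣U∣ =
      let v , Vv , le = exists-≤-average (λ v → sum (λ i → s i v * s i v)) V (+ m * (+ r - + t))
                          (λ v → ≤-trans (≤-reflexive (sym (sum-zero {m} (λ _ → refl)))) (sum-mono-≤ λ i → 0≤i² (s i v)))
                          (subst (0ℤ <_) (sym ∣V∣) (+<+ 0<t))
                          (≤-reflexive total)
      in  v , Vv , λ i → ≤-trans (≤-sum (λ j → 0≤i² (s j v)) i) le
      where
      open ≡-Reasoning
      s : Fin m → Fin r → ℤ
      s i = dev (λ x → ⟦ U i x ⟧)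
      factor : ∀ m r t → m * (r * t - t * t) ≡ t * (m * (r - t))
      factor = solve-∀
      moment : ∀ i → sum (λ v → s i v * s i v) ≡ + r * + t - + t * + t
      moment i = begin
        sum (λ v → s i v * s i v)
          ≡⟨ second-moment (λ x → ⟦ U i x ⟧) ⟩
        + r * sum (λ x → ⟦ U i x ⟧ * ⟦ U i x ⟧) - size (U i) * size (U i)
          ≡⟨ cong (λ z → + r * z - size (U i) * size (U i)) (sum-cong-≗ λ x → ⟦b⟧²≡⟦b⟧ (U i x)) ⟩
        + r * size (U i) - size (U i) * size (U i)
          ≡⟨ cong (λ z → + r * z - z * z) (∣U∣ i) ⟩
        + r * + t - + t * + t ∎
      total : sum (λ v → sum λ i → s i v * s i v) ≡ size V * (+ m * (+ r - + t))
      total = begin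
        sum (λ v → sum λ i → s i v * s i v)  ≡⟨ ∑-comm (λ v i → s i v * s i v) ⟩
        sum (λ i → sum λ v → s i v * s i v)  ≡⟨ sum-cong-≗ moment ⟩
        sum {m} (λ _ → + r * + t - + t * + t) ≡⟨ sum-const m _ ⟩
        + m * (+ r * + t - + t * + t)        ≡⟨ factor (+ m) (+ r) (+ t) ⟩
        + t * (+ m * (+ r - + t))            ≡⟨ cong (_* (+ m * (+ r - + t))) ∣V∣ ⟨
        size V * (+ m * (+ r - + t))         ∎

    -- With r = Q², m (Q² - t) is strictly below (m Q)² because m and t are positive; the gap is m
    -- ((m - 1) Q² + t). Quantifying over `e` bounds the deviation on both sides.
    deviation-bound : ∀ {Q m t s} → r ≡ Q ℕ.* Q → 0 ℕ.< t → 0 ℕ.< m →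
                      s * s ≤ + m * (+ r - + t) → ∀ e → - (sgn e * s) < + (m ℕ.* Q)
    deviation-bound {Q} {suc m} {suc t} {s} refl _ _ s² e = a²<b²⇒a<b (suc m ℕ.* Q) (begin-strict
      - (sgn e * s) * - (sgn e * s)              ≡⟨ unsign e ⟩
      s * s                                      ≤⟨ s² ⟩
      + suc m * (+ (Q ℕ.* Q) - + suc t)          ≡⟨ cong (λ z → + suc m * (z - + suc t)) (pos-* Q Q) ⟩
      + suc m * (+ Q * + Q - + suc t)            ≡⟨ +-identityʳ _ ⟨
      + suc m * (+ Q * + Q - + suc t) + 0ℤ       <⟨ +-monoʳ-< (+ suc m * (+ Q * + Q - + suc t)) (+<+ (ℕ.s≤s ℕ.z≤n)) ⟩
      + suc m * (+ Q * + Q - + suc t) + + (suc m ℕ.* suc (m ℕ.* (Q ℕ.* Q) ℕ.+ t))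
        ≡⟨ cong (_+_ (+ suc m * (+ Q * + Q - + suc t))) cast ⟩
      + suc m * (+ Q * + Q - + suc t) + + suc m * (1ℤ + (+ m * (+ Q * + Q) + + t))
        ≡⟨ identity (+ m) (+ Q) (+ t) ⟩
      (+ suc m * + Q) * (+ suc m * + Q)          ≡⟨ cong₂ _*_ (pos-* (suc m) Q) (pos-* (suc m) Q) ⟨
      + (suc m ℕ.* Q) * + (suc m ℕ.* Q)          ∎)
      where
      open ≤-Reasoning
      unsign : ∀ e → - (sgn e * s) * - (sgn e * s) ≡ s * s
      unsign true  = lem s where
        lem : ∀ s → - (1ℤ * s) * - (1ℤ * s) ≡ s * s
        lem = solve-∀
      unsign false = lem s where
        lem : ∀ s → - (-1ℤ * s) * - (-1ℤ * s) ≡ s * s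
        lem = solve-∀
      identity : ∀ m Q t → (1ℤ + m) * (Q * Q - (1ℤ + t)) + (1ℤ + m) * (1ℤ + (m * (Q * Q) + t))
                           ≡ ((1ℤ + m) * Q) * ((1ℤ + m) * Q)
      identity = solve-∀
      cast : + (suc m ℕ.* suc (m ℕ.* (Q ℕ.* Q) ℕ.+ t)) ≡ + suc m * (1ℤ + (+ m * (+ Q * + Q) + + t))
      cast = trans (pos-* (suc m) _) (cong (λ z → + suc m * (1ℤ + (z + + t)))
               (trans (pos-* m (Q ℕ.* Q)) (cong (+ m *_) (pos-* Q Q))))

    unrestrict : ∀ v e W x → restrict v e W x ≡ true → W x ≡ true × M x v ≡ sgn e
    unrestrict v e W x p with W x | M x v ℤ.≟ sgn e
    ... | true | yes q = refl , q

    -- The recursion for `threshold` is made for this: of 2 t + m Q elements, the part m Q absorbs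
    -- both the deviation and the lost point v, and half of the remaining 2 t is t.
    size-restrict-≥ : ∀ {Q m} → r ≡ Q ℕ.* Q → 0 ℕ.< m → ∀ v e W → size W ≡ + threshold Q (suc m) →
                      dev (λ x → ⟦ W x ⟧) v * dev (λ x → ⟦ W x ⟧) v ≤ + m * (+ r - + threshold Q (suc m)) →
                      + threshold Q m ≤ size (restrict v e W)
    size-restrict-≥ {Q} {m} r≡Q² 0<m v e W ∣W∣ s²≤ = *-cancelˡ-≤-pos (+ t) (size (restrict v e W)) (+ 2) (begin
      + 2 * + t                                          ≡⟨ +-identityʳ _ ⟨
      + 2 * + t + 0ℤ                                     ≤⟨ +-monoʳ-≤ (+ 2 * + t) (i≤j⇒0≤j-i small) ⟩
      + 2 * + t + (+ (m ℕ.* Q) - (1ℤ - sgn e * s))       ≡⟨ rearrange (+ t) (+ (m ℕ.* Q)) (sgn e * s) ⟨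
      + 2 * + t + + (m ℕ.* Q) + sgn e * s - 1ℤ           ≡⟨ cong (λ z → z + sgn e * s - 1ℤ) (trans ∣W∣ split) ⟨
      size W + sgn e * s - 1ℤ                            ≤⟨ size-restrict v e W ⟩
      + 2 * size (restrict v e W)                        ∎)
      where
      open ≤-Reasoning
      t = threshold Q m
      s = dev (λ x → ⟦ W x ⟧) v
      rearrange : ∀ t d x → + 2 * t + d + x - 1ℤ ≡ + 2 * t + (d - (1ℤ - x))
      rearrange = solve-∀
      split : + threshold Q (suc m) ≡ + 2 * + t + + (m ℕ.* Q)
      split = cong (_+ + (m ℕ.* Q)) (pos-* 2 t)
      small : 1ℤ - sgn e * s ≤ + (m ℕ.* Q)
      -- The strictness of the bound yields the extra 1 that covers the `- 1ℤ` of `size-restrict`.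
      small = i<j⇒suc[i]≤j (deviation-bound {Q} r≡Q² (0<threshold Q (suc m)) 0<m s²≤ e)

    -- The new vertex is taken from the candidate set of index `zero`; the other sets, trimmed
    -- first, are then restricted to the points correctly joined to it.
    split-off : ∀ {Q} → r ≡ Q ℕ.* Q → ∀ {m} (e : Fin m → Bool) (U : Fin (suc m) → Fin r → Bool) →
                (∀ i → + threshold Q (suc m) ≤ size (U i)) →
                ∃ λ v → U zero v ≡ true × ∃ λ (U′ : Fin m → Fin r → Bool) →
                  (∀ i x → U′ i x ≡ true → U (suc i) x ≡ true × M x v ≡ sgn (e i)) ×
                  (∀ i → + threshold Q m ≤ size (U′ i))
    split-off {Q} r≡Q² {m} e U ∣U∣ =
      let v , Wv , s²≤ = choose (W zero) (W ∘ suc) (0<threshold Q (suc m)) (∣W∣ zero) (∣W∣ ∘ suc)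
      in  v , W⊆U zero v Wv , (λ i → restrict v (e i) (W (suc i)))
            , (λ i x p → let Wx , Mx = unrestrict v (e i) (W (suc i)) x p in W⊆U (suc i) x Wx , Mx)
            , (λ i → size-restrict-≥ r≡Q² (0<n i) v (e i) (W (suc i)) (∣W∣ (suc i)) (s²≤ i))
      where
      trimmed : ∀ i → ∃ λ V → V ⊆ U i × size V ≡ + threshold Q (suc m)
      trimmed i = shrink (U i) (threshold Q (suc m)) (∣U∣ i)
      W : Fin (suc m) → Fin r → Bool
      W = proj₁ ∘ trimmed
      W⊆U : ∀ i → W i ⊆ U i
      W⊆U = proj₁ ∘ proj₂ ∘ trimmed
      ∣W∣ : ∀ i → size (W i) ≡ + threshold Q (suc m)
      ∣W∣ = proj₂ ∘ proj₂ ∘ trimmed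
      -- The existence of an index i in `Fin m` supplies 0 < m for the deviation bound.
      0<n : ∀ {n} → Fin n → 0 ℕ.< n
      0<n {suc n} _ = ℕ.s≤s ℕ.z≤n

    -- Embedding all vertices by induction.

    Realises : ∀ {m} → (Fin m → Fin m → Bool) → (Fin m → Fin r) → Set
    Realises A f = ∀ i j → i ≢ j → M (f i) (f j) ≡ sgn (A i j)

    realises-∷ : ∀ {m} (A : Fin (suc m) → Fin (suc m) → Bool) → (∀ i j → A i j ≡ A j i) → ∀ v f →
                 (∀ i → M (f i) v ≡ sgn (A (suc i) zero)) → Realises (λ i j → A (suc i) (suc j)) f →
                 Realises A (v ∷ f)
    realises-∷ A symA v f head tail zero    zero    i≢j = contradiction refl i≢j
    realises-∷ A symA v f head tail zero    (suc j) i≢j =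
      trans (symmetric v (f j)) (trans (head j) (cong sgn (symA (suc j) zero)))
    realises-∷ A symA v f head tail (suc i) zero    i≢j = head i
    realises-∷ A symA v f head tail (suc i) (suc j) i≢j = tail i j (i≢j ∘ cong suc)

    -- Arbitrary candidate sets make the induction work: membership in the restricted sets carries
    -- the adjacencies to the vertices already placed.
    embed : ∀ {Q} → r ≡ Q ℕ.* Q → ∀ m (A : Fin m → Fin m → Bool) (U : Fin m → Fin r → Bool) →
            (∀ i j → A i j ≡ A j i) → (∀ i → + threshold Q m ≤ size (U i)) →
            ∃ λ (f : Fin m → Fin r) → (∀ i → U i (f i) ≡ true) × Realises A f
    embed r≡Q² zero    A U symA ∣U∣ = (λ ()) , (λ ()) , λ ()
    embed {Q} r≡Q² (suc m) A U symA ∣U∣ =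
      let v , Uv , U′ , refine , ∣U′∣ = split-off {Q} r≡Q² (λ i → A (suc i) zero) U ∣U∣
          f , U′f , realises = embed {Q} r≡Q² m (λ i j → A (suc i) (suc j)) U′ (λ i j → symA (suc i) (suc j)) ∣U′∣
      in  v ∷ f
        , (λ { zero → Uv ; (suc i) → proj₁ (refine i (f i) (U′f i)) })
        , realises-∷ A symA v f (λ i → proj₂ (refine i (f i) (U′f i))) realises

  -- Growth of the thresholds.

  -- Adding (m + 1) Q turns the recursion into pure doubling. Thus the threshold is 2^m (Q + 1) - (m
  -- + 1) Q, stated without subtraction.
  threshold-closed : ∀ Q m → threshold Q m ℕ.+ suc m ℕ.* Q ≡ 2 ℕ.^ m ℕ.* suc Q
  threshold-closed Q zero    = refl
  threshold-closed Q (suc m) = trans (ℕ-identity (threshold Q m) m Q)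
    (trans (cong (2 ℕ.*_) (threshold-closed Q m)) (sym (ℕ.*-assoc 2 (2 ℕ.^ m) (suc Q))))
    where
    ℕ-identity : ∀ t m Q → 2 ℕ.* t ℕ.+ m ℕ.* Q ℕ.+ suc (suc m) ℕ.* Q ≡ 2 ℕ.* (t ℕ.+ suc m ℕ.* Q)
    ℕ-identity = ℕ-solve-∀

  threshold-≤ : ∀ {Q m} → 2 ℕ.^ m ℕ.≤ Q → threshold Q m ℕ.≤ Q ℕ.* Q
  threshold-≤ {Q} {m} 2^m≤Q = ℕ.+-cancelʳ-≤ Q _ _ (begin
    threshold Q m ℕ.+ Q             ≤⟨ ℕ.+-monoʳ-≤ (threshold Q m) (ℕ.m≤m+n Q (m ℕ.* Q)) ⟩
    threshold Q m ℕ.+ suc m ℕ.* Q   ≡⟨ threshold-closed Q m ⟩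
    2 ℕ.^ m ℕ.* suc Q               ≤⟨ ℕ.*-monoˡ-≤ (suc Q) 2^m≤Q ⟩
    Q ℕ.* suc Q                     ≡⟨ ℕ.*-suc Q Q ⟩
    Q ℕ.+ Q ℕ.* Q                   ≡⟨ ℕ.+-comm Q _ ⟩
    Q ℕ.* Q ℕ.+ Q                   ∎)
    where open ℕ.≤-Reasoning

  -- The induction starts with the whole vertex set, of size Q², as candidate set for every vertex.
  paley-universal : ∀ {r Q k} {M : Fin r → Fin r → ℤ} → IsPaleyMatrix M → r ≡ Q ℕ.* Q → 2 ℕ.^ k ℕ.≤ Q →
                    (A : Fin k → Fin k → Bool) → (∀ i j → A i j ≡ A j i) →
                    ∃ λ (f : Fin k → Fin r) → ∀ i j → i ≢ j → M (f i) (f j) ≡ sgn (A i j)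
  paley-universal {r} {Q} {k} paley r≡Q² 2^k≤Q A symA =
    let f , _ , adjacent = embed paley r≡Q² k A (λ _ _ → true) symA (λ _ → everything)
    in  f , adjacent
    where
    everything : + threshold Q k ≤ size {r} (λ _ → true)
    everything = ≤-trans (+≤+ (subst (threshold Q k ℕ.≤_) (sym r≡Q²) (threshold-≤ {m = k} 2^k≤Q)))
                   (≤-reflexive (sym (trans (sum-const r 1ℤ) (*-identityʳ (+ r)))))

  -- Parity and involutions.

  2z≢1 : ∀ z → + 2 * z ≢ 1ℤ
  2z≢1 z eq with ∣ z ∣ | trans (sym (abs-* (+ 2) z)) (cong ∣_∣ eq)
  ... | suc n | p with ℕ.+-suc n (n ℕ.+ 0) | ℕ.suc-injective p
  ...   | q | p′ with trans (sym q) p′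
  ...     | ()

  does-⇔ : ∀ {a b} {A : Set a} {B : Set b} (A? : Dec A) (B? : Dec B) → (A → B) → (B → A) →
           ⟦ does A? ⟧ ≡ ⟦ does B? ⟧
  does-⇔ (yes _) (yes _) f g = refl
  does-⇔ (no _)  (no _)  f g = refl
  does-⇔ (yes a) (no ¬b) f g = contradiction (f a) ¬b
  does-⇔ (no ¬a) (yes b) f g = contradiction (g b) ¬a

  ⟦yes⟧ : ∀ {a} {A : Set a} (A? : Dec A) → A → ⟦ does A? ⟧ ≡ 1ℤ
  ⟦yes⟧ A? a = cong ⟦_⟧ (dec-true A? a)

  ⟦no⟧ : ∀ {a} {A : Set a} (A? : Dec A) → ¬ A → ⟦ does A? ⟧ ≡ 0ℤ
  ⟦no⟧ A? ¬a = cong ⟦_⟧ (dec-false A? ¬a)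

  -- Each two-element orbit is represented by its smaller member. Reindexing by σ shows that the
  -- larger members contribute the same amount, so only fixed points matter modulo 2.
  sum-involution : ∀ {n} (σ : Fin n → Fin n) → (∀ i → σ (σ i) ≡ i) → (g : Fin n → ℤ) → (∀ i → g (σ i) ≡ g i) →
                   ∃ λ a → sum g ≡ + 2 * a + sum (λ i → ⟦ does (σ i ≟ i) ⟧ * g i)
  sum-involution σ σσ g gσ = sum below , (begin
    sum g                                        ≡⟨ sum-cong-≗ pointwise ⟩
    sum (λ i → (below i + below (σ i)) + fixed i) ≡⟨ ∑-distrib-+ (λ i → below i + below (σ i)) fixed ⟩
    sum (λ i → below i + below (σ i)) + sum fixed ≡⟨ cong (_+ sum fixed) (∑-distrib-+ below (below ∘ σ)) ⟩
    sum below + sum (below ∘ σ) + sum fixed       ≡⟨ cong (λ z → sum below + z + sum fixed) (sum-permute below (permutation σ σ σσ σσ)) ⟨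
    sum below + sum below + sum fixed             ≡⟨ cong (_+ sum fixed) (double (sum below)) ⟩
    + 2 * sum below + sum fixed                   ∎)
    where
    open ≡-Reasoning
    double : ∀ a → a + a ≡ + 2 * a
    double = solve-∀
    below fixed : Fin _ → ℤ
    below i = ⟦ does (i <? σ i) ⟧ * g i
    fixed i = ⟦ does (σ i ≟ i) ⟧ * g i
    pointwise : ∀ i → g i ≡ (below i + below (σ i)) + fixed i
    pointwise i rewrite σσ i | gσ i with <-cmp i (σ i)
    ... | tri< lt ne gt
      rewrite ⟦yes⟧ (i <? σ i) lt | ⟦no⟧ (σ i <? i) gt | ⟦no⟧ (σ i ≟ i) (ne ∘ sym) = lem (g i)
      where
      lem : ∀ x → x ≡ 1ℤ * x + 0ℤ * x + 0ℤ * x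
      lem = solve-∀
    ... | tri≈ lt eq gt
      rewrite ⟦no⟧ (i <? σ i) lt | ⟦no⟧ (σ i <? i) gt | ⟦yes⟧ (σ i ≟ i) (sym eq) = lem (g i)
      where
      lem : ∀ x → x ≡ 0ℤ * x + 0ℤ * x + 1ℤ * x
      lem = solve-∀
    ... | tri> lt ne gt
      rewrite ⟦no⟧ (i <? σ i) lt | ⟦yes⟧ (σ i <? i) gt | ⟦no⟧ (σ i ≟ i) (ne ∘ sym) = lem (g i)
      where
      lem : ∀ x → x ≡ 0ℤ * x + 1ℤ * x + 0ℤ * x
      lem = solve-∀

  -- Counting and arithmetic in a finite field.

  module _ {c ℓ r} (F : FiniteField c ℓ r) where
    private
      module F = FiniteField F
      module G = Algebra.Properties.Group F.+-group
      module R = Algebra.Properties.Ring F.ring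
      module S = Algebra.Solver.Ring.NaturalCoefficients.Default F.commutativeSemiring
    open F using (Carrier; _≈_; 0#; 1#; enum; enum-inj; enum-surj)
      renaming (_+_ to _⊕_; _*_ to _⊗_; -_ to ⊖_; _-_ to _⊝_; _≟_ to _≈?_)
    open Relation.Binary.Reasoning.Setoid F.setoid using (begin_; step-≈-⟩; step-≈-⟨; _∎)

    index : Carrier → Fin r
    index x = proj₁ (enum-surj x)

    enum-index : ∀ x → enum (index x) ≈ x
    enum-index x = proj₂ (enum-surj x)

    sumF : (Carrier → ℤ) → ℤ
    sumF g = sum (g ∘ enum)

    ind : Carrier → Carrier → ℤ
    ind x y = ⟦ does (x ≈? y) ⟧

    ind-⇔ : ∀ {x y x′ y′} → (x ≈ y → x′ ≈ y′) → (x′ ≈ y′ → x ≈ y) → ind x y ≡ ind x′ y′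
    ind-⇔ = does-⇔ (_ ≈? _) (_ ≈? _)

    sumF-ind : ∀ z (g : Carrier → ℤ) → (∀ {x y} → x ≈ y → g x ≡ g y) → sumF (λ x → ind x z * g x) ≡ g z
    sumF-ind z g g-cong = trans (sum-only _ (index z) off) on
      where
      off : ∀ i → i ≢ index z → ind (enum i) z * g (enum i) ≡ 0ℤ
      off i i≢z rewrite ⟦no⟧ (enum i ≈? z) (λ e → i≢z (enum-inj i (index z) (F.trans e (F.sym (enum-index z))))) = refl
      on : ind (enum (index z)) z * g (enum (index z)) ≡ g z
      on rewrite ⟦yes⟧ (enum (index z) ≈? z) (enum-index z) = trans (*-identityˡ _) (g-cong (enum-index z))

    count-unique : ∀ z {u v : Carrier → Carrier} → (∀ t → t ≈ z → u t ≈ v t) → (∀ t → u t ≈ v t → t ≈ z) →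
                   sumF (λ t → ind (u t) (v t)) ≡ 1ℤ
    count-unique z {u} {v} to from =
      trans (sum-cong-≗ {r} λ i → trans (ind-⇔ (from (enum i)) (to (enum i))) (sym (*-identityʳ _)))
            (sumF-ind z (λ _ → 1ℤ) (λ _ → refl))

    x⊝y≈z⇒x≈z⊕y : ∀ {x y z} → x ⊝ y ≈ z → x ≈ z ⊕ y
    x⊝y≈z⇒x≈z⊕y {x} {y} {z} e = begin
      x            ≈⟨ G.//-rightDividesˡ y x ⟨
      (x ⊝ y) ⊕ y  ≈⟨ F.+-congʳ e ⟩
      z ⊕ y        ∎

    x≈z⊕y⇒x⊝y≈z : ∀ {x y z} → x ≈ z ⊕ y → x ⊝ y ≈ z
    x≈z⊕y⇒x⊝y≈z {x} {y} {z} e = F.trans (F.+-congʳ e) (G.//-rightDividesʳ y z)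

    sumF-translate : ∀ t (g : Carrier → ℤ) → (∀ {x y} → x ≈ y → g x ≡ g y) → sumF g ≡ sumF (λ a → g (a ⊕ t))
    sumF-translate t g g-cong =
      trans (sum-permute (g ∘ enum) π) (sum-cong-≗ {r} λ i → g-cong (enum-index (enum i ⊕ t)))
      where
      π = permutation (λ i → index (enum i ⊕ t)) (λ i → index (enum i ⊝ t))
        (λ i → enum-inj _ _ (F.trans (enum-index _) (F.trans (F.+-congʳ (enum-index _)) (G.//-rightDividesˡ t (enum i)))))
        (λ i → enum-inj _ _ (F.trans (enum-index _) (F.trans (F.+-congʳ (enum-index _)) (G.//-rightDividesʳ t (enum i)))))

    ⊗-cancelˡ : ∀ {x y z} → ¬ x ≈ 0# → x ⊗ y ≈ x ⊗ z → y ≈ z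
    ⊗-cancelˡ {x} {y} {z} x≉0 e with F.inverse x x≉0
    ... | x⁻¹ , xx⁻¹≈1 = F.trans (F.sym (undo y)) (F.trans (F.*-congˡ e) (undo z))
      where
      undo : ∀ y → x⁻¹ ⊗ (x ⊗ y) ≈ y
      undo y = begin
        x⁻¹ ⊗ (x ⊗ y)  ≈⟨ F.*-assoc x⁻¹ x y ⟨
        (x⁻¹ ⊗ x) ⊗ y  ≈⟨ F.*-congʳ (F.trans (F.*-comm x⁻¹ x) xx⁻¹≈1) ⟩
        1# ⊗ y         ≈⟨ F.*-identityˡ y ⟩
        y              ∎

    xy≈0⇒y≈0 : ∀ {x y} → ¬ x ≈ 0# → x ⊗ y ≈ 0# → y ≈ 0#
    xy≈0⇒y≈0 {x} x≉0 xy≈0 = ⊗-cancelˡ x≉0 (F.trans xy≈0 (F.sym (F.zeroʳ x)))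

    s²≈0⇒s≈0 : ∀ {s} → s ⊗ s ≈ 0# → s ≈ 0#
    s²≈0⇒s≈0 {s} s²≈0 with s ≈? 0#
    ... | yes s≈0 = s≈0
    ... | no  s≉0 = xy≈0⇒y≈0 s≉0 s²≈0

    s²≈t²⇒s≈±t : ∀ {s t} → s ⊗ s ≈ t ⊗ t → s ≈ t ⊎ s ≈ ⊖ t
    s²≈t²⇒s≈±t {s} {t} s²≈t² with (s ⊝ t) ≈? 0#
    ... | yes s-t≈0 = inj₁ (G.x∙y⁻¹≈ε⇒x≈y s t s-t≈0)
    ... | no  s-t≉0 = inj₂ (G.inverseˡ-unique s t (xy≈0⇒y≈0 s-t≉0 (begin
      (s ⊝ t) ⊗ (s ⊕ t)                       ≈⟨ expand s (⊖ t) t ⟩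
      s ⊗ s ⊕ (s ⊗ (t ⊝ t) ⊕ ⊖ t ⊗ t)         ≈⟨ F.+-congʳ s²≈t² ⟩
      t ⊗ t ⊕ (s ⊗ (t ⊝ t) ⊕ ⊖ t ⊗ t)         ≈⟨ collect s (⊖ t) t ⟩
      (t ⊝ t) ⊗ (t ⊕ s)                       ≈⟨ F.*-congʳ (F.-‿inverseʳ t) ⟩
      0# ⊗ (t ⊕ s)                            ≈⟨ F.zeroˡ _ ⟩
      0#                                      ∎)))
      where
      -- Both identities hold in any commutative semiring, with `n` for `⊖ t`; that t + n vanishes
      -- enters only after `collect`.
      open S
      expand : ∀ s n t → (s ⊕ n) ⊗ (s ⊕ t) ≈ s ⊗ s ⊕ (s ⊗ (t ⊕ n) ⊕ n ⊗ t)
      expand = solve 3 (λ s n t → (s :+ n) :* (s :+ t) := s :* s :+ (s :* (t :+ n) :+ n :* t)) F.refl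
      collect : ∀ s n t → t ⊗ t ⊕ (s ⊗ (t ⊕ n) ⊕ n ⊗ t) ≈ (t ⊕ n) ⊗ (t ⊕ s)
      collect = solve 3 (λ s n t → t :* t :+ (s :* (t :+ n) :+ n :* t) := (t :+ n) :* (t :+ s)) F.refl

    [-s]²≈s² : ∀ s → ⊖ s ⊗ ⊖ s ≈ s ⊗ s
    [-s]²≈s² s = begin
      ⊖ s ⊗ ⊖ s    ≈⟨ R.-‿distribˡ-* s (⊖ s) ⟨
      ⊖ (s ⊗ ⊖ s)  ≈⟨ F.-‿cong (R.-‿distribʳ-* s s) ⟨
      ⊖ ⊖ (s ⊗ s)  ≈⟨ G.⁻¹-involutive (s ⊗ s) ⟩
      s ⊗ s        ∎

    -- Squares, square roots and the quadratic character.

    NonzeroSquare : Carrier → Set (c ⊔ ℓ)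
    NonzeroSquare x = ¬ x ≈ 0# × Σ Carrier λ s → s ⊗ s ≈ x

    root? : ∀ x → Dec (Σ Carrier λ s → s ⊗ s ≈ x)
    root? x = map′ (λ (i , e) → enum i , e)
                   (λ (s , e) → index s , F.trans (F.*-cong (enum-index s) (enum-index s)) e)
                   (any? λ i → (enum i ⊗ enum i) ≈? x)

    nonzeroSquare? : ∀ x → Dec (NonzeroSquare x)
    nonzeroSquare? x = ¬? (x ≈? 0#) ×-dec root? x

    isSquare : Carrier → ℤ
    isSquare x = ⟦ does (nonzeroSquare? x) ⟧

    roots : Carrier → ℤ
    roots x = sumF (λ s → ind (s ⊗ s) x)

    -- Exchanging the sums, each s is a square root of exactly one x.
    sum-roots : sumF roots ≡ + r
    sum-roots = trans (∑-comm {r} {r} (λ i j → ind (enum j ⊗ enum j) (enum i)))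
      (trans (sum-cong-≗ {r} λ j → count-unique (enum j ⊗ enum j) (λ _ → F.sym) (λ _ → F.sym))
             (trans (sum-const r 1ℤ) (*-identityʳ (+ r))))

    roots-zero : ∀ {x} → x ≈ 0# → roots x ≡ 1ℤ
    roots-zero x≈0 = count-unique 0# (λ t t≈0 → F.trans (F.*-cong t≈0 t≈0) (F.trans (F.zeroˡ 0#) (F.sym x≈0)))
                                     (λ t t²≈x → s²≈0⇒s≈0 (F.trans t²≈x x≈0))

    roots-nonsquare : ∀ {x} → (∀ s → ¬ s ⊗ s ≈ x) → roots x ≡ 0ℤ
    roots-nonsquare {x} ∄s = sum-zero {r} λ i → ⟦no⟧ ((enum i ⊗ enum i) ≈? x) (∄s (enum i))

    -- Sending 0 to 0 makes inversion an involution of the whole field, as `sum-involution`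
    -- requires.
    reciprocal : Carrier → Carrier
    reciprocal x with x ≈? 0#
    ... | yes _   = 0#
    ... | no  x≉0 = proj₁ (F.inverse x x≉0)

    reciprocal-zero : ∀ {x} → x ≈ 0# → reciprocal x ≈ 0#
    reciprocal-zero {x} x≈0 with x ≈? 0#
    ... | yes _   = F.refl
    ... | no  x≉0 = contradiction x≈0 x≉0

    reciprocal-inverse : ∀ {x} → ¬ x ≈ 0# → x ⊗ reciprocal x ≈ 1#
    reciprocal-inverse {x} x≉0 with x ≈? 0#
    ... | yes x≈0  = contradiction x≈0 x≉0
    ... | no  x≉0′ = proj₂ (F.inverse x x≉0′)

    xy≈1⇒x≉0 : ∀ {x y} → x ⊗ y ≈ 1# → ¬ x ≈ 0#
    xy≈1⇒x≉0 {x} {y} xy≈1 x≈0 = F.0≉1 (F.trans (F.sym (F.zeroˡ y)) (F.trans (F.*-congʳ (F.sym x≈0)) xy≈1))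

    square-reciprocal : ∀ {x y} → x ⊗ y ≈ 1# → NonzeroSquare x → NonzeroSquare y
    square-reciprocal {x} {y} xy≈1 (x≉0 , s , s²≈x) =
      xy≈1⇒x≉0 (F.trans (F.*-comm y x) xy≈1) , s′ , ⊗-cancelˡ x≉0 (begin
        x ⊗ (s′ ⊗ s′)          ≈⟨ F.*-congʳ s²≈x ⟨
        (s ⊗ s) ⊗ (s′ ⊗ s′)    ≈⟨ regroup s s′ ⟩
        (s ⊗ s′) ⊗ (s ⊗ s′)    ≈⟨ F.*-cong ss′≈1 ss′≈1 ⟩
        1# ⊗ 1#                ≈⟨ F.*-identityˡ 1# ⟩
        1#                     ≈⟨ xy≈1 ⟨
        x ⊗ y                  ∎)
      where
      open S
      s′ = reciprocal s
      ss′≈1 : s ⊗ s′ ≈ 1#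
      ss′≈1 = reciprocal-inverse (λ s≈0 → x≉0 (F.trans (F.sym s²≈x) (F.trans (F.*-congʳ s≈0) (F.zeroˡ s))))
      regroup : ∀ s t → (s ⊗ s) ⊗ (t ⊗ t) ≈ (s ⊗ t) ⊗ (s ⊗ t)
      regroup = solve 2 (λ s t → (s :* s) :* (t :* t) := (s :* t) :* (s :* t)) F.refl

    -- The quadratic character, read off from the fact that x has 1 + χ(x) square roots. Character
    -- sums thereby become counts of solutions.
    χ : Carrier → ℤ
    χ x = roots x - 1ℤ

    minus-flip : ∀ {x y z} → z ≈ x ⊝ y → y ≈ x ⊝ z
    minus-flip {x} {y} {z} e = F.sym (x≈z⊕y⇒x⊝y≈z (F.trans (x⊝y≈z⇒x≈z⊕y (F.sym e)) (F.+-comm z y)))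

    sum-roots-shifted : ∀ x → sumF (λ v → roots (x ⊝ v)) ≡ + r
    sum-roots-shifted x = trans (∑-comm {r} {r} (λ i j → ind (enum j ⊗ enum j) (x ⊝ enum i)))
      (trans (sum-cong-≗ {r} λ j → count-unique (x ⊝ (enum j ⊗ enum j)) (λ _ → minus-flip) (λ _ → minus-flip))
             (trans (sum-const r 1ℤ) (*-identityʳ (+ r))))

    count-linear : ∀ {b} → ¬ b ≈ 0# → ∀ c → sumF (λ t → ind (b ⊗ t) c) ≡ 1ℤ
    count-linear {b} b≉0 c = count-unique (b⁻¹ ⊗ c)
      (λ t e → F.trans (F.*-congˡ e) solution) (λ t e → ⊗-cancelˡ b≉0 (F.trans e (F.sym solution)))
      where
      b⁻¹ = proj₁ (F.inverse b b≉0)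
      solution : b ⊗ (b⁻¹ ⊗ c) ≈ c
      solution = F.trans (F.sym (F.*-assoc b b⁻¹ c))
        (F.trans (F.*-congʳ (proj₂ (F.inverse b b≉0))) (F.*-identityˡ c))

    -- Fields of order 1 modulo 4.

    module _ (B : ℕ) (r≡1+4B : r ≡ 1 ℕ.+ 4 ℕ.* B) where

      r-odd : + r ≡ 1ℤ + + 4 * + B
      r-odd = trans (cong +_ r≡1+4B) (cong (_+_ 1ℤ) (pos-* 4 B))

      -- If 1 + 1 were 0, translation by 1 would be an involution without fixed points, and r would
      -- be even.
      1+1≉0 : ¬ 1# ⊕ 1# ≈ 0#
      1+1≉0 2≈0 = 2z≢1 (a - + 2 * + B) (lem a (+ B) (trans (sym r-odd) r≡2a))
        where
        lem : ∀ a b → 1ℤ + + 4 * b ≡ + 2 * a → + 2 * (a - + 2 * b) ≡ 1ℤ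
        lem a b e = trans (lem₁ a b) (trans (cong (_- + 4 * b) (sym e)) (lem₂ b))
          where
          lem₁ : ∀ a b → + 2 * (a - + 2 * b) ≡ + 2 * a - + 4 * b
          lem₁ = solve-∀
          lem₂ : ∀ b → 1ℤ + + 4 * b - + 4 * b ≡ 1ℤ
          lem₂ = solve-∀
        σ : Fin r → Fin r
        σ i = index (enum i ⊕ 1#)
        σσ : ∀ i → σ (σ i) ≡ i
        σσ i = enum-inj _ _ (begin
          enum (σ (σ i))            ≈⟨ enum-index _ ⟩
          enum (σ i) ⊕ 1#           ≈⟨ F.+-congʳ (enum-index _) ⟩
          (enum i ⊕ 1#) ⊕ 1#        ≈⟨ F.+-assoc _ _ _ ⟩
          enum i ⊕ (1# ⊕ 1#)        ≈⟨ F.+-congˡ 2≈0 ⟩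
          enum i ⊕ 0#               ≈⟨ F.+-identityʳ _ ⟩
          enum i                    ∎)
        no-fixed : ∀ i → σ i ≢ i
        no-fixed i σi≡i = F.0≉1 (G.∙-cancelˡ (enum i) 0# 1#
          (F.trans (F.+-identityʳ _) (F.trans (F.reflexive (cong enum (sym σi≡i))) (enum-index _))))
        halves = sum-involution σ σσ (λ _ → 1ℤ) (λ _ → refl)
        a = proj₁ halves
        r≡2a : + r ≡ + 2 * a
        r≡2a = trans (sym (trans (sum-const r 1ℤ) (*-identityʳ (+ r))))
          (trans (proj₂ halves) (trans (cong (_+_ (+ 2 * a)) (sum-zero λ i → cong (_* 1ℤ) (⟦no⟧ (σ i ≟ i) (no-fixed i))))
            (+-identityʳ _)))

      x+x≈0⇒x≈0 : ∀ {x} → x ⊕ x ≈ 0# → x ≈ 0#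
      x+x≈0⇒x≈0 {x} e = xy≈0⇒y≈0 1+1≉0 (F.trans (F.distribʳ x 1# 1#)
        (F.trans (F.+-cong (F.*-identityˡ x) (F.*-identityˡ x)) e))

      roots-square : ∀ {x} → NonzeroSquare x → roots x ≡ + 2
      roots-square {x} (x≉0 , s , s²≈x) = trans (sum-cong-≗ {r} (pointwise ∘ enum))
        (trans (∑-distrib-+ {r} (λ i → ind (enum i) s) (λ i → ind (enum i) (⊖ s)))
          (cong₂ _+_ (count-unique s (λ _ e → e) (λ _ e → e)) (count-unique (⊖ s) (λ _ e → e) (λ _ e → e))))
        where
        s≉-s : ¬ s ≈ ⊖ s
        s≉-s e = x≉0 (F.trans (F.sym s²≈x) (F.trans (F.*-congʳ (x+x≈0⇒x≈0
          (F.trans (F.+-congˡ e) (F.-‿inverseʳ s)))) (F.zeroˡ s)))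
        pointwise : ∀ t → ind (t ⊗ t) x ≡ ind t s + ind t (⊖ s)
        pointwise t with t ≈? s | t ≈? (⊖ s)
        ... | yes p | yes q = contradiction (F.trans (F.sym p) q) s≉-s
        ... | yes p | no _  = ⟦yes⟧ ((t ⊗ t) ≈? x) (F.trans (F.*-cong p p) s²≈x)
        ... | no _  | yes q = ⟦yes⟧ ((t ⊗ t) ≈? x) (F.trans (F.*-cong q q) (F.trans ([-s]²≈s² s) s²≈x))
        ... | no p  | no q  = ⟦no⟧ ((t ⊗ t) ≈? x)
          (λ e → [ p , q ]′ (s²≈t²⇒s≈±t (F.trans e (F.sym s²≈x))))

      -- One formula for all three cases. Summed over the field it counts the nonzero squares, and
      -- it reduces the evenness of χ to that of two indicators.
      roots-spec : ∀ x → roots x ≡ + 2 * isSquare x + ind x 0#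
      roots-spec x = by-cases (x ≈? 0#) (nonzeroSquare? x)
        where
        value : ∀ {a b} → isSquare x ≡ a → ind x 0# ≡ b → + 2 * a + b ≡ + 2 * isSquare x + ind x 0#
        value p q = sym (cong₂ (λ a b → + 2 * a + b) p q)
        by-cases : Dec (x ≈ 0#) → Dec (NonzeroSquare x) → roots x ≡ + 2 * isSquare x + ind x 0#
        by-cases (yes x≈0) _ = trans (roots-zero x≈0)
          (value (⟦no⟧ (nonzeroSquare? x) (λ (x≉0 , _) → x≉0 x≈0)) (⟦yes⟧ (x ≈? 0#) x≈0))
        by-cases (no x≉0) (yes sq) = trans (roots-square sq)
          (value (⟦yes⟧ (nonzeroSquare? x) sq) (⟦no⟧ (x ≈? 0#) x≉0))
        by-cases (no x≉0) (no ¬sq) = trans (roots-nonsquare (λ s e → ¬sq (x≉0 , s , e)))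
          (value (⟦no⟧ (nonzeroSquare? x) ¬sq) (⟦no⟧ (x ≈? 0#) x≉0))

      -- If −1 were not a square, 1 would be the only fixed point of inversion on the
      -- nonzero squares, so their number (r − 1) / 2 would be odd.
      -1-square : Σ Carrier λ ι → ι ⊗ ι ≈ ⊖ 1#
      -1-square with root? (⊖ 1#)
      ... | yes found = found
      ... | no ∄ι = contradiction (parity a (+ B) (trans (sym r-odd) r≡)) (2z≢1 (+ B - a))
        where
        σ : Fin r → Fin r
        σ i = index (reciprocal (enum i))
        σ-zero : ∀ {i} → enum i ≈ 0# → enum (σ i) ≈ 0#
        σ-zero e = F.trans (enum-index _) (reciprocal-zero e)
        σ-inverse : ∀ {i} → ¬ enum i ≈ 0# → enum i ⊗ enum (σ i) ≈ 1#
        σ-inverse i≉0 = F.trans (F.*-congˡ (enum-index _)) (reciprocal-inverse i≉0)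
        σ-nonzero : ∀ {i} → ¬ enum i ≈ 0# → ¬ enum (σ i) ≈ 0#
        σ-nonzero i≉0 = xy≈1⇒x≉0 (F.trans (F.*-comm _ _) (σ-inverse i≉0))
        σσ : ∀ i → σ (σ i) ≡ i
        σσ i = enum-inj _ _ (by-cases (enum i ≈? 0#))
          where
          by-cases : Dec (enum i ≈ 0#) → enum (σ (σ i)) ≈ enum i
          by-cases (yes i≈0) = F.trans (σ-zero (σ-zero i≈0)) (F.sym i≈0)
          by-cases (no  i≉0) = ⊗-cancelˡ (σ-nonzero i≉0)
            (F.trans (σ-inverse (σ-nonzero i≉0)) (F.trans (F.sym (σ-inverse i≉0)) (F.*-comm _ _)))
        g : Fin r → ℤ
        g i = isSquare (enum i)
        gσ : ∀ i → g (σ i) ≡ g i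
        gσ i = does-⇔ (nonzeroSquare? _) (nonzeroSquare? _) from to
          where
          to : NonzeroSquare (enum i) → NonzeroSquare (enum (σ i))
          to sq = square-reciprocal (σ-inverse (proj₁ sq)) sq
          from : NonzeroSquare (enum (σ i)) → NonzeroSquare (enum i)
          from sq = square-reciprocal
            (F.trans (F.*-comm _ _) (σ-inverse (λ i≈0 → proj₁ sq (σ-zero i≈0)))) sq
        fixed : ∀ i → ⟦ does (σ i ≟ i) ⟧ * g i ≡ ind (enum i) 1#
        fixed i = by-cases (enum i ≈? 1#) (σ i ≟ i) (nonzeroSquare? (enum i))
          where
          by-cases : Dec (enum i ≈ 1#) → Dec (σ i ≡ i) → Dec (NonzeroSquare (enum i)) →
                     ⟦ does (σ i ≟ i) ⟧ * g i ≡ ind (enum i) 1#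
          by-cases (yes i≈1) _ _ = trans
            (cong₂ _*_ (⟦yes⟧ (σ i ≟ i) (enum-inj _ _ σi≈i)) (⟦yes⟧ (nonzeroSquare? (enum i)) sq))
            (sym (⟦yes⟧ (enum i ≈? 1#) i≈1))
            where
            i≉0 : ¬ enum i ≈ 0#
            i≉0 i≈0 = F.0≉1 (F.trans (F.sym i≈0) i≈1)
            i²≈1 : enum i ⊗ enum i ≈ 1#
            i²≈1 = F.trans (F.*-cong i≈1 i≈1) (F.*-identityˡ 1#)
            σi≈i : enum (σ i) ≈ enum i
            σi≈i = ⊗-cancelˡ i≉0 (F.trans (σ-inverse i≉0) (F.sym i²≈1))
            sq : NonzeroSquare (enum i)
            sq = i≉0 , 1# , F.trans (F.*-identityˡ 1#) (F.sym i≈1)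
          by-cases (no i≉1) (no σi≢i) _ =
            trans (cong (_* g i) (⟦no⟧ (σ i ≟ i) σi≢i)) (sym (⟦no⟧ (enum i ≈? 1#) i≉1))
          by-cases (no i≉1) (yes _) (no ¬sq) = trans (cong (⟦ does (σ i ≟ i) ⟧ *_) (⟦no⟧ (nonzeroSquare? (enum i)) ¬sq))
            (trans (*-zeroʳ ⟦ does (σ i ≟ i) ⟧) (sym (⟦no⟧ (enum i ≈? 1#) i≉1)))
          by-cases (no i≉1) (yes σi≡i) (yes (i≉0 , s , s²≈i)) =
            [ (λ i≈1 → contradiction i≈1 i≉1) , (λ i≈-1 → contradiction (s , F.trans s²≈i i≈-1) ∄ι) ]′
              (s²≈t²⇒s≈±t (begin
                enum i ⊗ enum i      ≈⟨ F.*-congˡ (F.reflexive (cong enum (sym σi≡i))) ⟩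
                enum i ⊗ enum (σ i)  ≈⟨ σ-inverse i≉0 ⟩
                1#                   ≈⟨ F.*-identityˡ 1# ⟨
                1# ⊗ 1#              ∎))
        pairs = sum-involution σ σσ g gσ
        a = proj₁ pairs
        squares : sum g ≡ + 2 * a + 1ℤ
        squares = trans (proj₂ pairs) (cong (_+_ (+ 2 * a))
          (trans (sum-cong-≗ fixed) (count-unique 1# (λ _ e → e) (λ _ e → e))))
        -- Here r = 2 · (number of nonzero squares) + 1 with an odd number of squares, so r would be
        -- 3 modulo 4.
        r≡ : + r ≡ + 2 * (+ 2 * a + 1ℤ) + 1ℤ
        r≡ = trans (sym sum-roots) (trans (sum-cong-≗ {r} (roots-spec ∘ enum))
          (trans (∑-distrib-+ {r} (λ i → + 2 * g i) (λ i → ind (enum i) 0#))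
            (cong₂ _+_ (trans (sym (*-distribˡ-sum (+ 2) g)) (cong (+ 2 *_) squares))
                       (count-unique 0# (λ _ e → e) (λ _ e → e)))))
        parity : ∀ a b → 1ℤ + + 4 * b ≡ + 2 * (+ 2 * a + 1ℤ) + 1ℤ → + 2 * (b - a) ≡ 1ℤ
        parity a b e = *-cancelˡ-≡ (+ 2) _ _ (trans (lem₁ a b) (trans (cong (_- (1ℤ + + 4 * a)) e) (lem₂ a)))
          where
          lem₁ : ∀ a b → + 2 * (+ 2 * (b - a)) ≡ 1ℤ + + 4 * b - (1ℤ + + 4 * a)
          lem₁ = solve-∀
          lem₂ : ∀ a → + 2 * (+ 2 * a + 1ℤ) + 1ℤ - (1ℤ + + 4 * a) ≡ + 2
          lem₂ = solve-∀

      -- A root of -1 times a root of x is a root of -x. Hence the Paley matrix is symmetric.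
      square-neg : ∀ {x y} → x ≈ ⊖ y → NonzeroSquare x → NonzeroSquare y
      square-neg {x} {y} x≈-y (x≉0 , s , s²≈x) = y≉0 , ι ⊗ s , (begin
        (ι ⊗ s) ⊗ (ι ⊗ s)  ≈⟨ regroup ι s ⟩
        (ι ⊗ ι) ⊗ (s ⊗ s)  ≈⟨ F.*-cong (proj₂ -1-square) (F.trans s²≈x x≈-y) ⟩
        ⊖ 1# ⊗ ⊖ y         ≈⟨ R.-1*x≈-x (⊖ y) ⟩
        ⊖ ⊖ y              ≈⟨ G.⁻¹-involutive y ⟩
        y                  ∎)
        where
        open S
        ι = proj₁ -1-square
        y≉0 : ¬ y ≈ 0#
        y≉0 y≈0 = x≉0 (F.trans x≈-y (F.trans (F.-‿cong y≈0) G.ε⁻¹≈ε))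
        regroup : ∀ s t → (s ⊗ t) ⊗ (s ⊗ t) ≈ (s ⊗ s) ⊗ (t ⊗ t)
        regroup = solve 2 (λ s t → (s :* t) :* (s :* t) := (s :* s) :* (t :* t)) F.refl

      -- Orthogonality of the quadratic character.

      module _ {x y : Carrier} (x≉y : ¬ x ≈ y) where

        -- The first equation forces v = x - s², so the sum over v has a single surviving term.
        eliminate-v : ∀ s t → sumF (λ v → ind (s ⊗ s) (x ⊝ v) * ind (t ⊗ t) (y ⊝ v)) ≡ ind (t ⊗ t) (y ⊝ (x ⊝ (s ⊗ s)))
        eliminate-v s t = trans
          (sum-cong-≗ {r} λ i → cong (_* ind (t ⊗ t) (y ⊝ enum i)) (ind-⇔ minus-flip minus-flip))
          (sumF-ind (x ⊝ (s ⊗ s)) (λ v → ind (t ⊗ t) (y ⊝ v))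
            (λ v≈w → ind-⇔ (λ e → F.trans e (F.+-congˡ (F.-‿cong v≈w)))
                            (λ e → F.trans e (F.+-congˡ (F.-‿cong (F.sym v≈w))))))

        -- With s = t + a the equation s² − t² = x − y becomes linear in t.
        linearise : ∀ a t → ind (t ⊗ t) (y ⊝ (x ⊝ ((a ⊕ t) ⊗ (a ⊕ t)))) ≡ ind ((a ⊕ a) ⊗ t) ((x ⊝ y) ⊝ (a ⊗ a))
        linearise a t = ind-⇔
          (λ e → F.sym (x≈z⊕y⇒x⊝y≈z (x≈z⊕y⇒x⊝y≈z (F.trans (x⊝y≈z⇒x≈z⊕y (minus-flip e)) expand))))
          (λ e → minus-flip (x≈z⊕y⇒x⊝y≈z (F.trans (x⊝y≈z⇒x≈z⊕y (x⊝y≈z⇒x≈z⊕y (F.sym e))) (F.sym expand))))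
          where
          open S
          collect : ∀ a t y n → (y ⊕ n) ⊕ (a ⊕ t) ⊗ (a ⊕ t) ≈ (((a ⊕ a) ⊗ t ⊕ a ⊗ a) ⊕ y) ⊕ (t ⊗ t ⊕ n)
          collect = solve 4 (λ a t y n → (y :+ n) :+ (a :+ t) :* (a :+ t)
                              := (((a :+ a) :* t :+ a :* a) :+ y) :+ (t :* t :+ n)) F.refl
          expand : (y ⊝ (t ⊗ t)) ⊕ (a ⊕ t) ⊗ (a ⊕ t) ≈ ((a ⊕ a) ⊗ t ⊕ a ⊗ a) ⊕ y
          expand = F.trans (collect a t y (⊖ (t ⊗ t))) (F.trans (F.+-congˡ (F.-‿inverseʳ (t ⊗ t))) (F.+-identityʳ _))

        -- For a ≠ 0 the coefficient 2a is invertible and there is one solution. For a = 0 the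
        -- equation reads 0 = x - y and has none.
        count-t : ∀ a → sumF (λ t → ind ((a ⊕ a) ⊗ t) ((x ⊝ y) ⊝ (a ⊗ a))) ≡ 1ℤ - ind a 0#
        count-t a with a ≈? 0#
        ... | no  a≉0 = count-linear (λ 2a≈0 → a≉0 (x+x≈0⇒x≈0 2a≈0)) _
        ... | yes a≈0 = sum-zero {r} λ i → ⟦no⟧ (_ ≈? _) λ e → x≉y (G.x∙y⁻¹≈ε⇒x≈y x y
                (F.trans (x⊝y≈z⇒x≈z⊕y (F.sym e)) (begin
                  (a ⊕ a) ⊗ enum i ⊕ a ⊗ a     ≈⟨ F.+-cong (F.*-congʳ (F.+-cong a≈0 a≈0)) (F.*-congʳ a≈0) ⟩
                  (0# ⊕ 0#) ⊗ enum i ⊕ 0# ⊗ a  ≈⟨ F.+-cong (F.*-congʳ (F.+-identityˡ 0#)) (F.zeroˡ a) ⟩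
                  0# ⊗ enum i ⊕ 0#             ≈⟨ F.+-identityʳ _ ⟩
                  0# ⊗ enum i                  ≈⟨ F.zeroˡ _ ⟩
                  0#                           ∎)))

        -- This counts triples (v, s, t) with s² = x - v and t² = y - v. After v is eliminated and s
        -- replaced by a + t, each nonzero a accounts for exactly one triple.
        sum-roots-product : sumF (λ v → roots (x ⊝ v) * roots (y ⊝ v)) ≡ + r - 1ℤ
        sum-roots-product = ≡begin
          sumF (λ v → roots (x ⊝ v) * roots (y ⊝ v))
            ≡⟨ sum-cong-≗ {r} (λ i → trans (*-distribʳ-sum (roots (y ⊝ enum i)) (λ j → P j i))
                 (sum-cong-≗ {r} λ j → *-distribˡ-sum (P j i) (λ k → Q k i))) ⟩
          sum {r} (λ i → sum {r} λ j → sum {r} λ k → P j i * Q k i)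
            ≡⟨ ∑-comm {r} {r} (λ i j → sum {r} λ k → P j i * Q k i) ⟩
          sum {r} (λ j → sum {r} λ i → sum {r} λ k → P j i * Q k i)
            ≡⟨ sum-cong-≗ {r} (λ j → trans (∑-comm {r} {r} (λ i k → P j i * Q k i))
                 (sum-cong-≗ {r} λ k → eliminate-v (enum j) (enum k))) ⟩
          sumF (λ s → sumF λ t → H s t)
            ≡⟨ ∑-comm {r} {r} (λ j k → H (enum j) (enum k)) ⟩
          sumF (λ t → sumF λ s → H s t)
            ≡⟨ sum-cong-≗ {r} (λ k → trans (sumF-translate (enum k) (λ s → H s (enum k)) (H-cong (enum k)))
                 (sum-cong-≗ {r} λ j → linearise (enum j) (enum k))) ⟩
          sumF (λ t → sumF λ a → ind ((a ⊕ a) ⊗ t) ((x ⊝ y) ⊝ (a ⊗ a)))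
            ≡⟨ ∑-comm {r} {r} (λ k j → ind ((enum j ⊕ enum j) ⊗ enum k) ((x ⊝ y) ⊝ (enum j ⊗ enum j))) ⟩
          sumF (λ a → sumF λ t → ind ((a ⊕ a) ⊗ t) ((x ⊝ y) ⊝ (a ⊗ a)))
            ≡⟨ sum-cong-≗ {r} (λ j → count-t (enum j)) ⟩
          sumF (λ a → 1ℤ - ind a 0#)
            ≡⟨ sum-minus {r} (λ _ → 1ℤ) (λ j → ind (enum j) 0#) ⟩
          sum {r} (λ _ → 1ℤ) - sumF (λ a → ind a 0#)
            ≡⟨ cong₂ _-_ (trans (sum-const r 1ℤ) (*-identityʳ (+ r))) (count-unique 0# (λ _ e → e) (λ _ e → e)) ⟩
          + r - 1ℤ ≡∎
          where
          open ≡-Reasoning using (step-≡-⟩) renaming (begin_ to ≡begin_; _∎ to _≡∎)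
          P Q : Fin r → Fin r → ℤ
          P j i = ind (enum j ⊗ enum j) (x ⊝ enum i)
          Q k i = ind (enum k ⊗ enum k) (y ⊝ enum i)
          H : Carrier → Carrier → ℤ
          H s t = ind (t ⊗ t) (y ⊝ (x ⊝ (s ⊗ s)))
          H-cong : ∀ t {s s′} → s ≈ s′ → H s t ≡ H s′ t
          H-cong t e = ind-⇔ (λ p → F.trans p (move e)) (λ p → F.trans p (move (F.sym e)))
            where
            move : ∀ {s s′} → s ≈ s′ → y ⊝ (x ⊝ (s ⊗ s)) ≈ y ⊝ (x ⊝ (s′ ⊗ s′))
            move e = F.+-congˡ (F.-‿cong (F.+-congˡ (F.-‿cong (F.*-cong e e))))

        -- Expanding (p - 1)(q - 1) leaves the counts (r - 1) - r - r + r = -1.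
        χ-orthogonal : sumF (λ v → χ (x ⊝ v) * χ (y ⊝ v)) ≡ -1ℤ
        χ-orthogonal = ≡begin
          sumF (λ v → χ (x ⊝ v) * χ (y ⊝ v))
            ≡⟨ sum-cong-≗ {r} (λ i → expand (p i) (q i)) ⟩
          sum {r} (λ i → (p i * q i - p i) - (q i - 1ℤ))
            ≡⟨ sum-minus {r} (λ i → p i * q i - p i) (λ i → q i - 1ℤ) ⟩
          sum {r} (λ i → p i * q i - p i) - sum {r} (λ i → q i - 1ℤ)
            ≡⟨ cong₂ _-_ (sum-minus {r} (λ i → p i * q i) p) (sum-minus {r} q (λ _ → 1ℤ)) ⟩
          (sum {r} (λ i → p i * q i) - sum {r} p) - (sum {r} q - sum {r} (λ _ → 1ℤ))
            ≡⟨ cong₂ _-_ (cong₂ _-_ sum-roots-product (sum-roots-shifted x))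
                         (cong₂ _-_ (sum-roots-shifted y) (trans (sum-const r 1ℤ) (*-identityʳ (+ r)))) ⟩
          (+ r - 1ℤ - + r) - (+ r - + r)
            ≡⟨ cancel (+ r) ⟩
          -1ℤ ≡∎
          where
          open ≡-Reasoning using (step-≡-⟩) renaming (begin_ to ≡begin_; _∎ to _≡∎)
          p q : Fin r → ℤ
          p i = roots (x ⊝ enum i)
          q i = roots (y ⊝ enum i)
          expand : ∀ a b → (a - 1ℤ) * (b - 1ℤ) ≡ (a * b - a) - (b - 1ℤ)
          expand = solve-∀
          cancel : ∀ r → (r - 1ℤ - r) - (r - r) ≡ -1ℤ
          cancel = solve-∀

      -- The Paley matrix of a field and its induced subgraphs.

      χ-zero : ∀ {x} → x ≈ 0# → χ x ≡ 0ℤ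
      χ-zero x≈0 = cong (_- 1ℤ) (roots-zero x≈0)

      χ-square : ∀ {x} → NonzeroSquare x → χ x ≡ 1ℤ
      χ-square sq = cong (_- 1ℤ) (roots-square sq)

      χ-nonsquare : ∀ {x} → ¬ x ≈ 0# → ¬ NonzeroSquare x → χ x ≡ -1ℤ
      χ-nonsquare x≉0 ¬sq = cong (_- 1ℤ) (roots-nonsquare (λ s e → ¬sq (x≉0 , s , e)))

      χ-neg : ∀ {x y} → x ≈ ⊖ y → χ x ≡ χ y
      χ-neg {x} {y} x≈-y = cong (_- 1ℤ) (trans (roots-spec x) (trans
        (cong₂ (λ a b → + 2 * a + b)
          (does-⇔ (nonzeroSquare? x) (nonzeroSquare? y) (square-neg x≈-y) (square-neg y≈-x))
          (ind-⇔ (zero-neg y≈-x) (zero-neg x≈-y)))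
        (sym (roots-spec y))))
        where
        y≈-x : y ≈ ⊖ x
        y≈-x = F.trans (F.sym (G.⁻¹-involutive y)) (F.-‿cong (F.sym x≈-y))
        zero-neg : ∀ {u v} → v ≈ ⊖ u → u ≈ 0# → v ≈ 0#
        zero-neg v≈-u u≈0 = F.trans v≈-u (F.trans (F.-‿cong u≈0) G.ε⁻¹≈ε)

      paleyMatrix : Fin r → Fin r → ℤ
      paleyMatrix i j = χ (enum i ⊝ enum j)

      paleyMatrix-isPaley : IsPaleyMatrix paleyMatrix
      paleyMatrix-isPaley = record
        { diagonal   = λ i → χ-zero (F.-‿inverseʳ (enum i))
        ; sign       = λ {i} {j} i≢j → sign (λ e → i≢j (enum-inj i j (G.x∙y⁻¹≈ε⇒x≈y _ _ e)))
        ; symmetric  = λ i j → χ-neg (F.sym (G.⁻¹-anti-homo-// (enum j) (enum i)))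
        ; orthogonal = λ {i} {j} i≢j → χ-orthogonal (λ e → i≢j (enum-inj i j e))
        }
        where
        sign : ∀ {x} → ¬ x ≈ 0# → χ x ≡ 1ℤ ⊎ χ x ≡ -1ℤ
        sign {x} x≉0 with nonzeroSquare? x
        ... | yes sq = inj₁ (χ-square sq)
        ... | no ¬sq = inj₂ (χ-nonsquare x≉0 ¬sq)

      inducedInPaley : ∀ {Q k} → r ≡ Q ℕ.* Q → 2 ℕ.^ k ℕ.≤ Q → (G : Graph k) → InducedInPaley G F
      inducedInPaley {Q} {k} r≡Q² 2^k≤Q G =
        let f , realises = paley-universal paleyMatrix-isPaley r≡Q² 2^k≤Q adj (Graph.sym G)
        in  enum ∘ f , injective f realises , λ i j → mk⇔ (to f realises i j) (from f realises i j)
        where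
        open Graph G using (adj; irrefl)
        module _ (f : Fin k → Fin r) (realises : ∀ i j → i ≢ j → paleyMatrix (f i) (f j) ≡ sgn (adj i j)) where
          sgn≢0 : ∀ b → 0ℤ ≢ sgn b
          sgn≢0 true  ()
          sgn≢0 false ()

          -- Two vertices with the same image would have matrix entry χ(0) = 0, which is not a sign.
          injective : ∀ i j → enum (f i) ≈ enum (f j) → i ≡ j
          injective i j e with i ≟ j
          ... | yes i≡j = i≡j
          ... | no  i≢j = contradiction (trans (sym (χ-zero (G.x≈y⇒x∙y⁻¹≈ε e))) (realises i j i≢j)) (sgn≢0 (adj i j))

          to : ∀ i j → adj i j ≡ true → PaleyAdj F (enum (f i)) (enum (f j))
          to i j ij with i ≟ j
          ... | yes refl = contradiction (trans (sym ij) (irrefl i)) λ ()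
          ... | no  i≢j with nonzeroSquare? (enum (f i) ⊝ enum (f j))
          -- `NonzeroSquare` of the difference unfolds to `PaleyAdj`.
          ...   | yes sq = sq
          ...   | no ¬sq = contradiction
                  (trans (sym (χ-nonsquare (λ e → i≢j (injective i j (G.x∙y⁻¹≈ε⇒x≈y _ _ e))) ¬sq))
                         (trans (realises i j i≢j) (cong sgn ij))) λ ()

          from : ∀ i j → PaleyAdj F (enum (f i)) (enum (f j)) → adj i j ≡ true
          from i j sq with i ≟ j
          ... | yes refl = contradiction (F.-‿inverseʳ (enum (f i))) (proj₁ sq)
          ... | no  i≢j with adj i j | realises i j i≢j
          ...   | true  | _ = refl
          ...   | false | e = contradiction (trans (sym (χ-square sq)) e) λ ()

open PaleyUniversality using (inducedInPaley)
open import Data.Nat using (ℕ; _*_; _∸_; _^_; _≤_)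

-- Odd prime powers and numerical bounds.

odd-prime⇒2∤p : ∀ {p} → Prime p → p ≢ 2 → 2 ∤ p
odd-prime⇒2∤p p-prime p≢2 2∣p with prime⇒irreducible p-prime 2∣p
... | inj₂ 2≡p = p≢2 (sym 2≡p)

2∤p^n : ∀ {p} → 2 ∤ p → ∀ n → 2 ∤ p ^ n
2∤p^n     2∤p zero    2∣1 = contradiction (∣1⇒≡1 2∣1) λ ()
2∤p^n {p} 2∤p (suc n) 2∣  = [ 2∤p , 2∤p^n 2∤p n ]′ (euclidsLemma p (p ^ n) prime[2] 2∣)

-- Applied to Q, this supplies the `B` with r = Q² = 1 + 4B.
odd-square : ∀ {n} → 2 ∤ n → ∃ λ b → n * n ≡ 1 ℕ.+ 4 * b
odd-square {n} 2∤n with n % 2 | m%n<n n 2 | m%n≡0⇒n∣m n 2 | m≡m%n+[m/n]*n n 2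
... | 0           | _                         | 2∣n | _    = contradiction (2∣n refl) 2∤n
... | 1           | _                         | _   | n≡   = b ℕ.+ b * b , trans (cong₂ _*_ n≡ n≡) (expand b)
  where
  b = n / 2
  expand : ∀ b → (1 ℕ.+ b * 2) * (1 ℕ.+ b * 2) ≡ 1 ℕ.+ 4 * (b ℕ.+ b * b)
  expand = ℕ-solve-∀
... | suc (suc _) | ℕ.s≤s (ℕ.s≤s ()) | _   | _

odd-prime-power-≥3 : ∀ {p} → Prime p → p ≢ 2 → ∀ a → 3 ≤ p ^ suc a
odd-prime-power-≥3 {p} p-prime p≢2 a = begin
  3          ≤⟨ ℕ.≤∧≢⇒< 2≤p (p≢2 ∘ sym) ⟩
  p          ≡⟨ ℕ.*-identityʳ p ⟨
  p * 1      ≤⟨ ℕ.*-monoʳ-≤ p (ℕ.m^n>0 p {{ℕ.>-nonZero (ℕ.<⇒≤ 2≤p)}} a) ⟩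
  p ^ suc a  ∎
  where
  open ℕ.≤-Reasoning
  2≤p : 2 ≤ p
  2≤p = ℕ.nonTrivial⇒n>1 p {{prime⇒nonTrivial p-prime}}

n<b^n : ∀ {b} → 2 ≤ b → ∀ n → n ℕ.< b ^ n
n<b^n     2≤b zero    = ℕ.s≤s ℕ.z≤n
n<b^n {b} 2≤b (suc n) = begin-strict
  suc n            <⟨ ℕ.s≤s (n<b^n 2≤b n) ⟩
  1 ℕ.+ b ^ n      ≤⟨ ℕ.+-mono-≤ (ℕ.≤-<-trans ℕ.z≤n (n<b^n 2≤b n)) (ℕ.m≤m+n (b ^ n) 0) ⟩
  2 * b ^ n        ≤⟨ ℕ.*-monoˡ-≤ (b ^ n) 2≤b ⟩
  b ^ suc n        ∎
  where open ℕ.≤-Reasoning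

-- For k ≥ 5 the factor k - 1 is at least 4, and 4 · 2^(k-2) = 2^k. At k = 4 the second hypothesis
-- gives only 12 ≤ Q, short of 16; the constant 27 = 3³ is the least value of q^(3^n) for odd q ≥ 3
-- and n ≥ 1.
2^k≤ : ∀ k {Q} → 27 ≤ Q → (k ∸ 1) * 2 ^ (k ∸ 2) ≤ Q → 2 ^ k ≤ Q
2^k≤ 0 27≤Q _ = ℕ.≤-trans (ℕ.≤ᵇ⇒≤ 1 27 _) 27≤Q
2^k≤ 1 27≤Q _ = ℕ.≤-trans (ℕ.≤ᵇ⇒≤ 2 27 _) 27≤Q
2^k≤ 2 27≤Q _ = ℕ.≤-trans (ℕ.≤ᵇ⇒≤ 4 27 _) 27≤Q
2^k≤ 3 27≤Q _ = ℕ.≤-trans (ℕ.≤ᵇ⇒≤ 8 27 _) 27≤Q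
2^k≤ 4 27≤Q _ = ℕ.≤-trans (ℕ.≤ᵇ⇒≤ 16 27 _) 27≤Q
2^k≤ (suc (suc (suc (suc (suc j))))) {Q} _ bound = begin
  2 ^ (5 ℕ.+ j)              ≡⟨ ℕ.*-assoc 2 2 (2 ^ (3 ℕ.+ j)) ⟨
  4 * 2 ^ (3 ℕ.+ j)          ≤⟨ ℕ.*-monoˡ-≤ (2 ^ (3 ℕ.+ j)) (ℕ.m≤m+n 4 j) ⟩
  (4 ℕ.+ j) * 2 ^ (3 ℕ.+ j)  ≤⟨ bound ⟩
  Q                          ∎
  where open ℕ.≤-Reasoning

-- The choice of n.

least : ∀ {ℓ} {P : ℕ → Set ℓ} → (∀ n → Dec (P n)) → ∀ b → P b → ∃ λ n → P n × (∀ m → P m → n ≤ m)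
least P? zero    Pb = 0 , Pb , λ _ _ → ℕ.z≤n
least P? (suc b) Pb with P? 0
... | yes P0 = 0 , P0 , λ _ _ → ℕ.z≤n
... | no ¬P0 =
  let n , Pn , minimal = least (P? ∘ suc) b Pb
  in  suc n , Pn , λ { zero P0 → contradiction P0 ¬P0 ; (suc m) Pm → ℕ.s≤s (minimal m Pm) }

-- The inequality K ≤ q^(3^m) says log_3 log_q K ≤ m wherever the logarithms exist, so lying below
-- all such m ≥ 1 encodes the ceiling. Where the double logarithm is undefined or at most 1, the
-- resulting bound is 1.
theorem5p3 : ∀ (c ℓ : Level) (q k : ℕ) → OddPrimePower q → (G : Graph k) →
    Σ ℕ λ n → 1 ≤ n ×
    ((m : ℕ) → 1 ≤ m → (k ∸ 1) * 2 ^ (k ∸ 2) ≤ q ^ (3 ^ m) → n ≤ m) ×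
    InP c ℓ q n G
theorem5p3 c ℓ q k (p , a , p-prime , p≢2 , refl) G =
  -- The search runs over j with n = `suc j`, so that n ≥ 1. It is bounded by `K` itself, since
  -- q^(3^(K+1)) exceeds K.
  let j , bound , minimal = least (λ j → K ℕ.≤? q ^ (3 ^ suc j)) K K≤
      B , Q²≡1+4B = odd-square (2∤Q (suc j))
  in  suc j , ℕ.s≤s ℕ.z≤n , (λ { (suc m) _ le → ℕ.s≤s (minimal m le) }) ,
      λ F → inducedInPaley F B (trans (square (3 ^ suc j)) Q²≡1+4B) {q ^ (3 ^ suc j)} (square (3 ^ suc j))
              (2^k≤ k (27≤Q j) bound) G
  where
  K = (k ∸ 1) * 2 ^ (k ∸ 2)
  3≤q : 3 ≤ q
  3≤q = odd-prime-power-≥3 p-prime p≢2 a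
  2≤q : 2 ≤ q
  2≤q = ℕ.≤-trans (ℕ.n≤1+n 2) 3≤q
  K≤ : K ≤ q ^ (3 ^ suc K)
  K≤ = ℕ.<⇒≤ (ℕ.<-trans (ℕ.<-trans (ℕ.n<1+n K) (n<b^n (ℕ.n≤1+n 2) (suc K))) (n<b^n 2≤q (3 ^ suc K)))
  2∤Q : ∀ n → 2 ∤ q ^ (3 ^ n)
  2∤Q n = 2∤p^n (2∤p^n (odd-prime⇒2∤p p-prime p≢2) (suc a)) (3 ^ n)
  27≤Q : ∀ j → 27 ≤ q ^ (3 ^ suc j)
  27≤Q j = ℕ.≤-trans (ℕ.^-monoʳ-≤ 3 (ℕ.*-monoʳ-≤ 3 (ℕ.m^n>0 3 j))) (ℕ.^-monoˡ-≤ (3 ^ suc j) 3≤q)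
  square : ∀ N → (q ^ 2) ^ N ≡ q ^ N * q ^ N
  square N = begin
    (q ^ 2) ^ N    ≡⟨ ℕ.^-*-assoc q 2 N ⟩
    q ^ (2 * N)    ≡⟨ cong (q ^_) (cong (N ℕ.+_) (ℕ.+-identityʳ N)) ⟩
    q ^ (N ℕ.+ N)  ≡⟨ ℕ.^-distribˡ-+-* q N N ⟩
    q ^ N * q ^ N  ∎
    where open ≡-Reasoning
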